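{- For every integer $n\ge 2$, none of the Fibonacci numbers $F_1,F_2,\ldots,F_n$ is an eigenvalue of the Fibonacci--Redheffer matrix $F_R(n)$; that is, $F_j\notin\sigma(F_R(n))$ for $j=1,2,\ldots,n$.
   Context: The Fibonacci numbers are $F_1=F_2=1$, $F_n=F_{n-1}+F_{n-2}$ for $n\ge 3$. The Fibonacci--Redheffer matrix $F_R(n)=[F_R(i,j)]_{i,j=1}^n$ is defined by $F_R(i,j)=1$ if $j=1$; $F_R(i,j)=F_i$ if $i\mid j$; and $F_R(i,j)=0$ otherwise. $\sigma(A)$ denotes the set of eigenvalues of a square matrix $A$. -}

module Defs where

open import Level using (Level; _⊔_)
open import Algebra.Apartness.Bundles using (HeytingCommutativeRing; HeytingField)
open import Algebra.Bundles using (CommutativeRing)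
import Algebra.Definitions.RawMonoid as RawMonoidDefs
open import Data.Bool.Base using (if_then_else_)
open import Data.Fin.Base using (Fin; toℕ)
open import Data.Nat.Base using (ℕ; zero; suc; _+_)
open import Data.Nat.Properties using (_≟_)
open import Data.Nat.Divisibility using (_∣?_)
open import Data.Product.Base using (∃-syntax; _×_)
open import Data.Vec.Functional using (Vector)
open import Relation.Nullary.Decidable.Core using (⌊_⌋)
open import Relation.Nullary.Negation.Core using (¬_)
open import Relation.Unary using (Pred)

-- The value fib 0 = 0 only serves the recursion: fib 1 = fib 2 = 1.
fib : ℕ → ℕ
fib zero          = 0
fib (suc zero)    = 1
fib (suc (suc n)) = fib (suc n) + fib n

-- The indices i and j are 1-based here.
fibRedhefferEntry : ℕ → ℕ → ℕ
fibRedhefferEntry i j =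
  if ⌊ j ≟ 1 ⌋ then 1
  else if ⌊ i ∣? j ⌋ then fib i
  else 0

module _ {c ℓ₁ ℓ₂ : Level} (K : HeytingField c ℓ₁ ℓ₂) where

  private
    module K = HeytingField K
    ring : CommutativeRing c ℓ₁
    ring = HeytingCommutativeRing.commutativeRing K.heytingCommutativeRing
    module Sum = RawMonoidDefs (CommutativeRing.+-rawMonoid ring)

  Matrix : ℕ → Set c
  Matrix n = Fin n → Fin n → K.Carrier

  fromℕ : ℕ → K.Carrier
  fromℕ m = m Sum.× K.1#

  -- The case m = 0 says that K is nontrivial, which HeytingField does not
  -- require.
  CharacteristicZero : Set ℓ₁
  CharacteristicZero = ∀ m → ¬ (fromℕ (suc m) K.≈ K.0#)

  _*ᵥ_ : ∀ {n} → Matrix n → Vector K.Carrier n → Vector K.Carrier n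
  (A *ᵥ v) i = Sum.sum (λ j → A i j K.* v j)

  -- The set of eigenvalues.  An eigenvector v is only required not to be
  -- equal to 0, which is weaker than having an entry apart from 0.
  σ : ∀ {n} → Matrix n → Pred K.Carrier (c ⊔ ℓ₁)
  σ A μ = ∃[ v ] (¬ (∀ i → v i K.≈ K.0#)) × (∀ i → (A *ᵥ v) i K.≈ μ K.* v i)

  -- Shifts the 0-based positions of Fin n to 1-based indices.
  fibRedheffer : (n : ℕ) → Matrix n
  fibRedheffer n i j = fromℕ (fibRedhefferEntry (suc (toℕ i)) (suc (toℕ j)))

{-# OPTIONS --safe #-}
module Submission where

-- Read row i ≥ 2 of F_R(n) v = F_j v as v₁ + F_i Σ_{k > i, i ∣ k} v_k = (F_j − F_i) v_i; since
-- F₁ = F₂ we may assume j ≥ 2.  Solving downwards from i = n to i = j + 1 gives v_k = −c_k v₁ with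
-- 0 ≤ c_k ≤ 1 / (F_k − F_j), because F_{mi} − F_j ≥ 2^{m−1} F_i for m ≥ 2 makes
-- F_i Σ_{k > i, i ∣ k} c_k < 1.  Row j then says (1 − F_j Σ_{k > j, j ∣ k} c_k) v₁ = 0, whence
-- v₁ = 0 and v_k = 0 for k > j.  Solving the rows i < j now gives v_k = e_k v_j with e_k ≥ 0 and e_j = 1,
-- so row 1 forces v_j = 0, and hence v = 0.  Only an abelian group without torsion is needed:
-- the coefficients are kept as fractions of natural numbers with a common denominator.

open import Defs
open import Level using (Level; _⊔_)
open import Algebra.Apartness.Bundles using (HeytingField; HeytingCommutativeRing)
open import Algebra.Bundles using (AbelianGroup; CommutativeMonoid; CommutativeRing)
import Algebra.Properties.AbelianGroup as AbelianGroupProperties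
import Algebra.Properties.CommutativeMonoid.Mult as Mult
import Algebra.Properties.CommutativeSemigroup as CommutativeSemigroupProperties
import Algebra.Properties.Monoid.Sum as MonoidSum
import Algebra.Properties.Ring as RingProperties
import Algebra.Properties.Semiring.Mult as SemiringMult
open import Data.Fin.Base as Fin using (Fin; toℕ)
open import Data.Fin.Properties using (toℕ-fromℕ; toℕ-fromℕ<; toℕ-inject₁; toℕ<n)
open import Data.Nat.Base using (ℕ; zero; suc; pred; _+_; _*_; _∸_; _^_; _≤_; _<_; z≤n; s≤s; >-nonZero; _≤′_; ≤′-refl; ≤′-step)
open import Data.Nat.Divisibility using (_∣_; _∣?_; divides; ∣⇒≤; ∣-refl; 1∣_)
open import Data.Nat.Properties
open import Data.Nat.Tactic.RingSolver using (solve-∀)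
open import Data.Product.Base using (∃-syntax; _×_; _,_; proj₁; proj₂)
open import Data.Sum.Base using (_⊎_; inj₁; inj₂)
open import Data.Vec.Functional using (Vector; tail)
open import Function.Base using (_∘_)
open import Relation.Binary.Definitions using (tri<; tri≈; tri>)
open import Relation.Binary.PropositionalEquality as ≡ using (_≡_; _≢_)
import Relation.Binary.Reasoning.Setoid as SetoidReasoning
open import Relation.Nullary using (yes; no; contradiction)
open import Relation.Unary using (_∉_)

-- Growth of the Fibonacci numbers

fib-step-≤ : ∀ n → 1 ≤ n → fib n ≤ fib (suc n)
fib-step-≤ (suc n) _ = m≤m+n (fib (suc n)) (fib n)

fib-mono-≤ : ∀ {m n} → 1 ≤ m → m ≤ n → fib m ≤ fib n
fib-mono-≤ {m} {n} 1≤m m≤n =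
  ≡.subst (λ k → fib m ≤ fib k) (m∸n+n≡m m≤n) (go (n ∸ m))
  where
  go : ∀ d → fib m ≤ fib (d + m)
  go zero    = ≤-refl
  go (suc d) = ≤-trans (go d) (fib-step-≤ (d + m) (≤-trans 1≤m (m≤n+m m d)))

fib-step-< : ∀ n → 2 ≤ n → fib n < fib (suc n)
fib-step-< (suc zero) (s≤s ())
fib-step-< (suc (suc n)) _ = m<m+n (fib (2 + n)) (fib-mono-≤ {1} {suc n} ≤-refl (s≤s z≤n))

fib-mono-< : ∀ {m n} → 2 ≤ m → m < n → fib m < fib n
fib-mono-< 2≤m m<n = <-≤-trans (fib-step-< _ 2≤m) (fib-mono-≤ (s≤s z≤n) m<n)

fib-double : ∀ {i} k → 2 ≤ i → 1 ≤ k → 2 * fib k ≤ fib (i + k)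
fib-double {i} k 2≤i 1≤k = begin
  2 * fib k             ≡⟨ ≡.cong (fib k +_) (+-identityʳ (fib k)) ⟩
  fib k + fib k         ≤⟨ +-monoˡ-≤ (fib k) (fib-step-≤ k 1≤k) ⟩
  fib (2 + k)           ≤⟨ fib-mono-≤ (s≤s z≤n) (+-monoˡ-≤ k 2≤i) ⟩
  fib (i + k)           ∎
  where open ≤-Reasoning

-- For i ≥ 3 one has F_{i+3} = 2 F_{i+1} + F_i and i + 3 ≤ 2i; the case i = 2 is the equality 3 F_2
-- = F_4.
fib-triple : ∀ i → 2 ≤ i → 3 * fib i ≤ fib (i + i)
fib-triple (suc zero) (s≤s ())
fib-triple (suc (suc zero)) _ = ≤-refl
fib-triple i@(suc (suc (suc i′))) _ = begin
  3 * fib i                       ≡⟨ eq₁ (fib i) ⟩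
  fib i + fib i + fib i           ≤⟨ +-monoˡ-≤ (fib i) (+-mono-≤ up up) ⟩
  fib (1 + i) + fib (1 + i) + fib i ≡⟨ eq₂ (fib (1 + i)) (fib i) ⟩
  fib (3 + i)                     ≤⟨ fib-mono-≤ (s≤s z≤n) (+-monoˡ-≤ i (m≤m+n 3 i′)) ⟩
  fib (i + i)                     ∎
  where
  open ≤-Reasoning
  up : fib i ≤ fib (1 + i)
  up = fib-step-≤ i (s≤s z≤n)
  eq₁ : ∀ x → 3 * x ≡ x + x + x
  eq₁ = solve-∀
  eq₂ : ∀ x y → x + x + y ≡ x + y + x
  eq₂ = solve-∀

-- Passing to the next multiple of i at least doubles the value, and 2(p + 1) exceeds 2p + 1. The
-- summand 1 is the room that `fib-gap` spends on F_j ≤ F_i.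
fib-multiple : ∀ i → 2 ≤ i → ∀ m → fib i * (2 ^ suc m + 1) ≤ fib ((2 + m) * i)
fib-multiple i 2≤i zero = begin
  fib i * 3        ≡⟨ *-comm (fib i) 3 ⟩
  3 * fib i        ≤⟨ fib-triple i 2≤i ⟩
  fib (i + i)      ≡⟨ ≡.cong (λ k → fib (i + k)) (+-identityʳ i) ⟨
  fib (2 * i)      ∎
  where open ≤-Reasoning
fib-multiple i 2≤i (suc m) = begin
  fib i * (2 * p + 1)       ≤⟨ *-monoʳ-≤ (fib i) (+-monoʳ-≤ (2 * p) (s≤s z≤n)) ⟩
  fib i * (2 * p + 2)       ≡⟨ eq (fib i) p ⟩
  2 * (fib i * (p + 1))     ≤⟨ *-monoʳ-≤ 2 (fib-multiple i 2≤i m) ⟩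
  2 * fib ((2 + m) * i)     ≤⟨ fib-double ((2 + m) * i) 2≤i
                                 (≤-trans (≤-trans (s≤s z≤n) 2≤i) (m≤m+n i ((1 + m) * i))) ⟩
  fib ((3 + m) * i)         ∎
  where
  open ≤-Reasoning
  p = 2 ^ suc m
  eq : ∀ x y → x * (2 * y + 2) ≡ 2 * (x * (y + 1))
  eq = solve-∀

fib-gap : ∀ {i j} → 2 ≤ i → 1 ≤ j → j ≤ i → ∀ m →
          fib i * 2 ^ suc m ≤ fib ((2 + m) * i) ∸ fib j
fib-gap {i} {j} 2≤i 1≤j j≤i m = m+n≤o⇒m≤o∸n (fib i * p) (begin
  fib i * p + fib j     ≤⟨ +-monoʳ-≤ (fib i * p) (fib-mono-≤ 1≤j j≤i) ⟩
  fib i * p + fib i     ≡⟨ eq (fib i) p ⟩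
  fib i * (p + 1)       ≤⟨ fib-multiple i 2≤i m ⟩
  fib ((2 + m) * i)     ∎)
  where
  open ≤-Reasoning
  p = 2 ^ suc m
  eq : ∀ x y → x * y + x ≡ x * (y + 1)
  eq = solve-∀

-- Row i of the matrix away from the first column and the diagonal

remainder : ℕ → ℕ → ℕ
remainder i k with k ≟ i | i ∣? k
... | yes _ | _     = 0
... | no _  | yes _ = fib i
... | no _  | no _  = 0

remainder-cases : ∀ i k → 1 ≤ k →
                  remainder i k ≡ 0 ⊎ (i < k × i ∣ k × remainder i k ≡ fib i)
remainder-cases i k 1≤k with k ≟ i | i ∣? k
... | yes _   | _       = inj₁ ≡.refl
... | no _    | no _    = inj₁ ≡.refl
... | no k≢i  | yes i∣k = inj₂ (≤∧≢⇒< (∣⇒≤ i∣k) (k≢i ∘ ≡.sym) , i∣k , ≡.refl)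
  where instance _ = >-nonZero 1≤k

-- Finite sums over 1, ..., n in a commutative monoid

module RangeSum {c ℓ} (M : CommutativeMonoid c ℓ) where
  open CommutativeMonoid M
  open CommutativeSemigroupProperties commutativeSemigroup using (interchange)
  open MonoidSum monoid using (sum; sum-cong-≋; sum-init-last)

  -- The range is 1, …, n.
  sumTo : (ℕ → Carrier) → ℕ → Carrier
  sumTo f zero    = ε
  sumTo f (suc n) = sumTo f n ∙ f (suc n)

  sumTo-cong : ∀ {f g} n → (∀ k → 1 ≤ k → k ≤ n → f k ≈ g k) → sumTo f n ≈ sumTo g n
  sumTo-cong zero    f≈g = refl
  sumTo-cong (suc n) f≈g =
    ∙-cong (sumTo-cong n (λ k 1≤k k≤n → f≈g k 1≤k (m≤n⇒m≤1+n k≤n))) (f≈g (suc n) (s≤s z≤n) ≤-refl)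

  sumTo-ε : ∀ {f} n → (∀ k → 1 ≤ k → k ≤ n → f k ≈ ε) → sumTo f n ≈ ε
  sumTo-ε zero    f≈ε = refl
  sumTo-ε (suc n) f≈ε = trans
    (∙-cong (sumTo-ε n (λ k 1≤k k≤n → f≈ε k 1≤k (m≤n⇒m≤1+n k≤n))) (f≈ε (suc n) (s≤s z≤n) ≤-refl))
    (identityʳ ε)

  sumTo-∙ : ∀ f g n → sumTo (λ k → f k ∙ g k) n ≈ sumTo f n ∙ sumTo g n
  sumTo-∙ f g zero    = sym (identityʳ ε)
  sumTo-∙ f g (suc n) = trans (∙-congʳ (sumTo-∙ f g n)) (interchange _ _ _ _)

  -- Serves to cut the first column and the diagonal out of a row, each as a sum with a single term.
  at : ℕ → Carrier → ℕ → Carrier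
  at i x k with k ≟ i
  ... | yes _ = x
  ... | no _  = ε

  at-≢ : ∀ {i x k} → k ≢ i → at i x k ≈ ε
  at-≢ {i} {x} {k} k≢i with k ≟ i
  ... | yes k≡i = contradiction k≡i k≢i
  ... | no _    = refl

  at-≡ : ∀ i x → at i x i ≈ x
  at-≡ i x with i ≟ i
  ... | yes _  = refl
  ... | no i≢i = contradiction ≡.refl i≢i

  sumTo-at : ∀ {i} x n → 1 ≤ i → i ≤ n → sumTo (at i x) n ≈ x
  sumTo-at x zero    1≤i i≤0 = contradiction (≤-trans 1≤i i≤0) λ ()
  sumTo-at {i} x (suc n) 1≤i i≤1+n with m≤n⇒m<n∨m≡n i≤1+n
  ... | inj₁ (s≤s i≤n) = trans
    (∙-cong (sumTo-at x n 1≤i i≤n) (at-≢ (λ 1+n≡i → <-irrefl (≡.sym 1+n≡i) (s≤s i≤n))))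
    (identityʳ x)
  ... | inj₂ ≡.refl = trans
    (∙-cong (sumTo-ε n (λ k _ k≤n → at-≢ (λ k≡i → <-irrefl k≡i (s≤s k≤n)))) (at-≡ (suc n) x))
    (identityˡ x)

  -- The library sum recurses on its first term and `sumTo` on its last, hence `sum-init-last`.
  sum≈sumTo : ∀ f n → sum {n} (λ i → f (suc (toℕ i))) ≈ sumTo f n
  sum≈sumTo f zero    = refl
  sum≈sumTo f (suc n) = trans (sum-init-last {n} (λ i → f (suc (toℕ i)))) (∙-cong
    (trans (sum-cong-≋ {n} (λ i → reflexive (≡.cong (f ∘ suc) (toℕ-inject₁ i)))) (sum≈sumTo f n))
    (reflexive (≡.cong (f ∘ suc) (toℕ-fromℕ n))))

-- A geometric bound for the off-diagonal part of a row

module ℕ-Sum = RangeSum +-0-commutativeMonoid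

term≤sumTo : ∀ f {i} n → 1 ≤ i → i ≤ n → f i ≤ ℕ-Sum.sumTo f n
term≤sumTo f zero    1≤i i≤0 = contradiction (≤-trans 1≤i i≤0) λ ()
term≤sumTo f (suc n) 1≤i i≤1+n with m≤n⇒m<n∨m≡n i≤1+n
... | inj₁ (s≤s i≤n) = ≤-trans (term≤sumTo f n 1≤i i≤n) (m≤m+n _ _)
... | inj₂ ≡.refl    = m≤n+m _ _

-- If N k ≤ D / (fib k − fib j) at the multiples k of i, then the m-th multiple contributes
-- fib i · N k ≤ D / 2 ^ (m − 1), and a finite geometric sum stays below D.
module RemainderBound
  {i j D n : ℕ} (N : ℕ → ℕ) (2≤i : 2 ≤ i) (1≤j : 1 ≤ j) (j≤i : j ≤ i)
  (bound : ∀ k → i < k → k ≤ n → N k * (fib k ∸ fib j) ≤ D)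
  where
  open ≤-Reasoning

  S : ℕ → ℕ
  S = ℕ-Sum.sumTo (λ k → remainder i k * N k)

  S-initial : ∀ t → t ≤ i → S t ≡ 0
  S-initial t t≤i = ℕ-Sum.sumTo-ε t term
    where
    term : ∀ k → 1 ≤ k → k ≤ t → remainder i k * N k ≡ 0
    term k 1≤k k≤t with remainder-cases i k 1≤k
    ... | inj₁ r≡0           = ≡.cong (_* N k) r≡0
    ... | inj₂ (i<k , _ , _) = contradiction (≤-trans k≤t t≤i) (<⇒≱ i<k)

  -- With m + 1 positive multiples of i up to t, the last clause says S t ≤ D (1 - 2^(-m)), the
  -- value of D/2 + ... + D/2^m, freed of subtraction and division.
  Invariant : ℕ → ℕ → Set
  Invariant t m = suc m * i ≤ t × t < (2 + m) * i × S t * 2 ^ m + D ≤ D * 2 ^ m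

  multiple-term : ∀ t m → suc t ≤ n → suc t ≡ (2 + m) * i →
                  remainder i (suc t) * N (suc t) * 2 ^ suc m ≤ D
  multiple-term t m t<n 1+t≡ with remainder-cases i (suc t) (s≤s z≤n)
  ... | inj₁ r≡0 rewrite r≡0 = z≤n
  ... | inj₂ (i<1+t , _ , r≡) = begin
    remainder i (suc t) * N (suc t) * 2 ^ suc m ≡⟨ ≡.cong (λ r → r * N (suc t) * 2 ^ suc m) r≡ ⟩
    fib i * N (suc t) * 2 ^ suc m               ≡⟨ eq (fib i) (N (suc t)) (2 ^ suc m) ⟩
    N (suc t) * (fib i * 2 ^ suc m)             ≤⟨ *-monoʳ-≤ (N (suc t)) (fib-gap 2≤i 1≤j j≤i m) ⟩
    N (suc t) * (fib ((2 + m) * i) ∸ fib j)     ≡⟨ ≡.cong (λ k → N (suc t) * (fib k ∸ fib j)) 1+t≡ ⟨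
    N (suc t) * (fib (suc t) ∸ fib j)           ≤⟨ bound (suc t) i<1+t t<n ⟩
    D                                           ∎
    where
    eq : ∀ x y z → x * y * z ≡ y * (x * z)
    eq = solve-∀

  non-multiple-term : ∀ t m → suc m * i ≤ t → suc t < (2 + m) * i →
                      remainder i (suc t) * N (suc t) ≡ 0
  non-multiple-term t m lo hi with remainder-cases i (suc t) (s≤s z≤n)
  ... | inj₁ r≡0 = ≡.cong (_* N (suc t)) r≡0
  -- The quotient q would lie strictly between m + 1 and m + 2.
  ... | inj₂ (_ , divides q 1+t≡ , _) = contradiction
    (*-cancelʳ-< i q (2 + m) (≡.subst (_< (2 + m) * i) 1+t≡ hi))
    (≤⇒≯ (*-cancelʳ-< i (suc m) q (≡.subst (suc m * i <_) 1+t≡ (s≤s lo))))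

  invariant : ∀ t → i ≤ t → t ≤ n → ∃[ m ] Invariant t m
  invariant zero    i≤0 _ = contradiction (≤-trans 2≤i i≤0) λ ()
  invariant (suc t) i≤1+t t<n with m≤n⇒m<n∨m≡n i≤1+t
  -- The multiple i itself is the diagonal position and adds nothing, so the invariant starts as an
  -- equality.
  ... | inj₂ ≡.refl = 0 , ≤-reflexive (+-identityʳ i) , m<m+n i (s≤s z≤n) , (begin
    S i * 1 + D ≡⟨ ≡.cong (λ s → s * 1 + D) (S-initial i ≤-refl) ⟩
    D           ≡⟨ *-identityʳ D ⟨
    D * 1       ∎)
  ... | inj₁ (s≤s i≤t) with invariant t i≤t (<⇒≤ t<n)
  ...   | m , lo , hi , b with m≤n⇒m<n∨m≡n hi
  ...     | inj₁ 1+t<  = m , m≤n⇒m≤1+n lo , 1+t< , (begin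
    (S t + remainder i (suc t) * N (suc t)) * 2 ^ m + D
      ≡⟨ ≡.cong (λ s → (S t + s) * 2 ^ m + D) (non-multiple-term t m lo 1+t<) ⟩
    (S t + 0) * 2 ^ m + D
      ≡⟨ ≡.cong (λ s → s * 2 ^ m + D) (+-identityʳ (S t)) ⟩
    S t * 2 ^ m + D
      ≤⟨ b ⟩
    D * 2 ^ m ∎)
  -- At a new multiple, doubling the old inequality leaves a spare D, which absorbs the new term
  -- times 2^(m+1).
  ...     | inj₂ 1+t≡ = suc m , ≤-reflexive (≡.sym 1+t≡) ,
                        ≡.subst (_< (3 + m) * i) (≡.sym 1+t≡) (m<n+m _ (≤-trans (s≤s z≤n) 2≤i)) , (begin
    (S t + x) * 2 ^ suc m + D              ≡⟨ eq₁ (S t) x (2 ^ m) D ⟩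
    2 * (S t * 2 ^ m) + D + x * 2 ^ suc m  ≤⟨ +-monoʳ-≤ (2 * (S t * 2 ^ m) + D) (multiple-term t m t<n 1+t≡) ⟩
    2 * (S t * 2 ^ m) + D + D              ≡⟨ eq₂ (S t * 2 ^ m) D ⟩
    2 * (S t * 2 ^ m + D)                  ≤⟨ *-monoʳ-≤ 2 b ⟩
    2 * (D * 2 ^ m)                        ≡⟨ eq₃ D (2 ^ m) ⟩
    D * 2 ^ suc m                          ∎)
    where
    x = remainder i (suc t) * N (suc t)
    eq₁ : ∀ s x p d → (s + x) * (2 * p) + d ≡ 2 * (s * p) + d + x * (2 * p)
    eq₁ = solve-∀
    eq₂ : ∀ s d → 2 * s + d + d ≡ 2 * (s + d)
    eq₂ = solve-∀
    eq₃ : ∀ d p → 2 * (d * p) ≡ d * (2 * p)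
    eq₃ = solve-∀

  remainder-sum< : 0 < D → i ≤ n → S n < D
  remainder-sum< 0<D i≤n with invariant n i≤n ≤-refl
  ... | m , _ , _ , b = *-cancelʳ-< (2 ^ m) (S n) D (<-≤-trans (m<m+n (S n * 2 ^ m) 0<D) b)

-- Rows are solved from the last one upwards in the matrix; `_≤′_` lets the recursion peel off the
-- upper end n.
descend : ∀ {a} {Q : ℕ → Set a} {lo n} → lo ≤′ n →
          (∀ i → lo ≤ i → i < n → Q (suc i) → Q i) → Q n → Q lo
descend ≤′-refl          step q = q
descend (≤′-step lo≤′n) step q =
  descend lo≤′n (λ i lo≤i i<n → step i lo≤i (m<n⇒m<1+n i<n)) (step _ (≤′⇒≤ lo≤′n) ≤-refl q)

-- Linear elimination in torsion-free abelian groups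

IsTorsionFree : ∀ {c ℓ} → AbelianGroup c ℓ → Set (c ⊔ ℓ)
IsTorsionFree G = ∀ m {x} → 0 < m → m · x ≈ ε → x ≈ ε
  where
  open AbelianGroup G
  open Mult commutativeMonoid renaming (_×_ to _·_)

module TorsionFree {c ℓ} (G : AbelianGroup c ℓ) (torsionFree : IsTorsionFree G) where
  open AbelianGroup G
  open Mult commutativeMonoid renaming (_×_ to _·_)
  open AbelianGroupProperties G using (∙-cancelˡ; ∙-cancelʳ; identityʳ-unique; inverseʳ-unique; ⁻¹-injective; ε⁻¹≈ε)
  open CommutativeSemigroupProperties commutativeSemigroup using (x∙yz≈y∙xz)
  open RangeSum commutativeMonoid
  open SetoidReasoning setoid

  ·-ε : ∀ m → m · ε ≈ ε
  ·-ε zero    = refl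
  ·-ε (suc m) = trans (identityˡ _) (·-ε m)

  ·-swap : ∀ m n x → m · (n · x) ≈ n · (m · x)
  ·-swap m n x = trans (×-assocˡ x m n) (trans (×-congˡ (*-comm m n)) (sym (×-assocˡ x n m)))

  ·-split : ∀ {m n} x → m ≤ n → n · x ≈ m · x ∙ (n ∸ m) · x
  ·-split {m} {n} x m≤n = trans (×-congˡ (≡.sym (m+[n∸m]≡n m≤n))) (×-homo-+ x m (n ∸ m))

  -- The alternative e k ≡ 0 allows entries that are not yet solved, provided that the row does not
  -- see them.
  sumTo-combination : ∀ {w : ℕ → Carrier} {u} D (e N : ℕ → ℕ) n →
    (∀ k → 1 ≤ k → k ≤ n → e k ≡ 0 ⊎ D · w k ≈ N k · u) →
    D · sumTo (λ k → e k · w k) n ≈ ℕ-Sum.sumTo (λ k → e k * N k) n · u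
  sumTo-combination D e N zero h = ·-ε D
  sumTo-combination {w} {u} D e N (suc n) h = begin
    D · (sumTo (λ k → e k · w k) n ∙ e (suc n) · w (suc n))
      ≈⟨ ×-distrib-+ _ _ D ⟩
    D · sumTo (λ k → e k · w k) n ∙ D · (e (suc n) · w (suc n))
      ≈⟨ ∙-cong (sumTo-combination D e N n (λ k 1≤k k≤n → h k 1≤k (m≤n⇒m≤1+n k≤n))) term ⟩
    ℕ-Sum.sumTo (λ k → e k * N k) n · u ∙ (e (suc n) * N (suc n)) · u
      ≈⟨ ×-homo-+ u (ℕ-Sum.sumTo (λ k → e k * N k) n) _ ⟨
    ℕ-Sum.sumTo (λ k → e k * N k) (suc n) · u ∎
    where
    term : D · (e (suc n) · w (suc n)) ≈ (e (suc n) * N (suc n)) · u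
    term with h (suc n) (s≤s z≤n) ≤-refl
    ... | inj₁ e≡0 rewrite e≡0 = ·-ε D
    ... | inj₂ eq = begin
      D · (e (suc n) · w (suc n))     ≈⟨ ·-swap D (e (suc n)) _ ⟩
      e (suc n) · (D · w (suc n))     ≈⟨ ×-congʳ (e (suc n)) eq ⟩
      e (suc n) · (N (suc n) · u)     ≈⟨ ×-assocˡ u (e (suc n)) (N (suc n)) ⟩
      (e (suc n) * N (suc n)) · u     ∎

  -- The entries w (1 + i), …, w n are the nonnegative rational multiples N k / D of u.
  record Solution (u : Carrier) (w : ℕ → Carrier) (P : ℕ → ℕ → ℕ → Set) (n i : ℕ) : Set ℓ where
    field
      D        : ℕ
      N        : ℕ → ℕ
      0<D      : 0 < D
      solves   : ∀ k → i < k → k ≤ n → D · w k ≈ N k · u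
      property : ∀ k → i < k → k ≤ n → P k D (N k)

  -- Enlarging the common denominator expands all earlier fractions, so what is known of them must
  -- survive expansion.
  Scalable : (ℕ → ℕ → ℕ → Set) → Set
  Scalable P = ∀ k D N d → 0 < d → P k D N → P k (d * D) (d * N)

  module _ {u : Carrier} {w : ℕ → Carrier} {P : ℕ → ℕ → ℕ → Set} {n : ℕ} where
    open Solution

    emptySolution : Solution u w P n n
    emptySolution .D = 1
    emptySolution .N _ = 0
    emptySolution .0<D = s≤s z≤n
    emptySolution .solves k n<k k≤n = contradiction k≤n (<⇒≱ n<k)
    emptySolution .property k n<k k≤n = contradiction k≤n (<⇒≱ n<k)

    extendSolution : ∀ {i} → Scalable P → (s : Solution u w P n (suc i)) →
      ∀ d M → 0 < d → (d * D s) · w (suc i) ≈ M · u → P (suc i) (d * D s) M →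
      Solution u w P n i
    extendSolution {i} scale s d M 0<d eq p = record
      { D = d * D s ; N = N′ ; 0<D = *-mono-≤ 0<d (0<D s) ; solves = solves′ ; property = property′ }
      where
      N′ : ℕ → ℕ
      N′ k with k ≟ suc i
      ... | yes _ = M
      ... | no _  = d * N s k
      solves′ : ∀ k → i < k → k ≤ n → (d * D s) · w k ≈ N′ k · u
      solves′ k i<k k≤n with k ≟ suc i
      ... | yes ≡.refl = eq
      ... | no k≢ = trans (sym (×-assocˡ (w k) d (D s)))
        (trans (×-congʳ d (solves s k (≤∧≢⇒< i<k (k≢ ∘ ≡.sym)) k≤n)) (×-assocˡ u d (N s k)))
      property′ : ∀ k → i < k → k ≤ n → P k (d * D s) (N′ k)
      property′ k i<k k≤n with k ≟ suc i
      ... | yes ≡.refl = p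
      ... | no k≢ = scale k (D s) (N s k) d 0<d (property s k (≤∧≢⇒< i<k (k≢ ∘ ≡.sym)) k≤n)

  -- For i ≥ 2 the first column and the diagonal are distinct positions and i does not divide 1, so
  -- no entry is counted twice.
  row-split : ∀ {i n} (w : ℕ → Carrier) → 2 ≤ i → i ≤ n →
    sumTo (λ k → fibRedhefferEntry i k · w k) n ≈
    w 1 ∙ (fib i · w i ∙ sumTo (λ k → remainder i k · w k) n)
  row-split {i} {n} w 2≤i i≤n = begin
    sumTo (λ k → fibRedhefferEntry i k · w k) n
      ≈⟨ sumTo-cong n (λ k _ _ → term k) ⟩
    sumTo (λ k → at 1 (w 1) k ∙ (at i (fib i · w i) k ∙ remainder i k · w k)) n
      ≈⟨ sumTo-∙ (at 1 (w 1)) _ n ⟩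
    sumTo (at 1 (w 1)) n ∙ sumTo (λ k → at i (fib i · w i) k ∙ remainder i k · w k) n
      ≈⟨ ∙-cong (sumTo-at (w 1) n ≤-refl (≤-trans 1≤i i≤n)) (sumTo-∙ (at i (fib i · w i)) _ n) ⟩
    w 1 ∙ (sumTo (at i (fib i · w i)) n ∙ sumTo (λ k → remainder i k · w k) n)
      ≈⟨ ∙-congˡ (∙-congʳ (sumTo-at (fib i · w i) n 1≤i i≤n)) ⟩
    w 1 ∙ (fib i · w i ∙ sumTo (λ k → remainder i k · w k) n) ∎
    where
    1≤i : 1 ≤ i
    1≤i = ≤-trans (s≤s z≤n) 2≤i
    term : ∀ k → fibRedhefferEntry i k · w k ≈ at 1 (w 1) k ∙ (at i (fib i · w i) k ∙ remainder i k · w k)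
    term k with k ≟ 1 | k ≟ i | i ∣? k
    ... | yes ≡.refl | yes ≡.refl | _       = contradiction 2≤i λ { (s≤s ()) }
    ... | yes ≡.refl | no _       | yes i∣1 = contradiction (∣⇒≤ i∣1) (<⇒≱ 2≤i)
    ... | yes ≡.refl | no _       | no _    = ∙-congˡ (sym (identityˡ ε))
    ... | no _       | yes ≡.refl | yes _   = sym (trans (identityˡ _) (identityʳ _))
    ... | no _       | yes ≡.refl | no i∤i  = contradiction ∣-refl i∤i
    ... | no _       | no _       | yes _   = sym (trans (identityˡ _) (identityˡ _))
    ... | no _       | no _       | no _    = sym (trans (identityˡ _) (identityˡ _))

  -- Solving the eigenvector equation for F_j row by row

  module Eigenvector
    {n j : ℕ} (2≤j : 2 ≤ j) (j≤n : j ≤ n) (w : ℕ → Carrier)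
    (rows : ∀ i → 1 ≤ i → i ≤ n → sumTo (λ k → fibRedhefferEntry i k · w k) n ≈ fib j · w i)
    where
    open Solution

    T : ℕ → Carrier
    T i = sumTo (λ k → remainder i k · w k) n

    split-rows : ∀ {i} → 2 ≤ i → i ≤ n → w 1 ∙ (fib i · w i ∙ T i) ≈ fib j · w i
    split-rows 2≤i i≤n = trans (sym (row-split w 2≤i i≤n)) (rows _ (≤-trans (s≤s z≤n) 2≤i) i≤n)

    -- The sign makes all coefficients with respect to u natural numbers.
    u : Carrier
    u = w 1 ⁻¹

    -- Cancelling F_j w_i on both sides of row i leaves w_1 plus the left-hand side equal to zero.
    row-≥j : ∀ {i} → j ≤ i → i ≤ n → (fib i ∸ fib j) · w i ∙ T i ≈ u
    row-≥j {i} j≤i i≤n = inverseʳ-unique (w 1) _ (identityʳ-unique (fib j · w i) _ (begin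
      fib j · w i ∙ (w 1 ∙ (d · w i ∙ T i))   ≈⟨ x∙yz≈y∙xz _ _ _ ⟩
      w 1 ∙ (fib j · w i ∙ (d · w i ∙ T i))   ≈⟨ ∙-congˡ (assoc _ _ _) ⟨
      w 1 ∙ (fib j · w i ∙ d · w i ∙ T i)     ≈⟨ ∙-congˡ (∙-congʳ (·-split (w i) (fib-mono-≤ (≤-trans (s≤s z≤n) 2≤j) j≤i))) ⟨
      w 1 ∙ (fib i · w i ∙ T i)               ≈⟨ split-rows (≤-trans 2≤j j≤i) i≤n ⟩
      fib j · w i                             ∎))
      where d = fib i ∸ fib j

    remainder-combination : ∀ {v P i} (s : Solution v w P n i) →
      D s · T i ≈ ℕ-Sum.sumTo (λ k → remainder i k * N s k) n · v
    remainder-combination {i = i} s = sumTo-combination (D s) (remainder i) (N s) n term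
      where
      term : ∀ k → 1 ≤ k → k ≤ n → remainder i k ≡ 0 ⊎ D s · w k ≈ N s k · _
      term k 1≤k k≤n with remainder-cases i k 1≤k
      ... | inj₁ r≡0           = inj₁ r≡0
      ... | inj₂ (i<k , _ , _) = inj₂ (solves s k i<k k≤n)

    -- The bound N / D ≤ 1 / (F_k - F_j) for k > j, in the form that `RemainderBound` takes.
    SmallRatio : ℕ → ℕ → ℕ → Set
    SmallRatio k D N = N * (fib k ∸ fib j) ≤ D

    smallRatio-scalable : Scalable SmallRatio
    smallRatio-scalable k D N d _ p =
      ≤-trans (≤-reflexive (*-assoc d N (fib k ∸ fib j))) (*-monoʳ-≤ d p)

    -- Over the denominator D this is 1 - F_i Σ c_k; by `remainder<` the truncated subtraction is a
    -- true one.
    rest : ∀ {i} → Solution u w SmallRatio n i → ℕ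
    rest {i} s = D s ∸ ℕ-Sum.sumTo (λ k → remainder i k * N s k) n

    remainder< : ∀ {i} → j ≤ i → i ≤ n → (s : Solution u w SmallRatio n i) →
                 ℕ-Sum.sumTo (λ k → remainder i k * N s k) n < D s
    remainder< j≤i i≤n s =
      RemainderBound.remainder-sum< (N s) (≤-trans 2≤j j≤i) (≤-trans (s≤s z≤n) 2≤j) j≤i
        (property s) (0<D s) i≤n

    -- Row i is multiplied by D and the known multiple of u is cancelled. The case i = j is
    -- included: there the left-hand side becomes zero.
    eliminate : ∀ {i} → j ≤ i → i ≤ n → (s : Solution u w SmallRatio n i) →
                ((fib i ∸ fib j) * D s) · w i ≈ rest s · u
    eliminate {i} j≤i i≤n s = ∙-cancelʳ (E · u) _ _ (begin
      (d * D s) · w i ∙ E · u      ≈⟨ ∙-cong (×-congˡ (*-comm d (D s))) (sym (remainder-combination s)) ⟩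
      (D s * d) · w i ∙ D s · T i  ≈⟨ ∙-congʳ (×-assocˡ (w i) (D s) d) ⟨
      D s · (d · w i) ∙ D s · T i  ≈⟨ ×-distrib-+ _ _ (D s) ⟨
      D s · (d · w i ∙ T i)        ≈⟨ ×-congʳ (D s) (row-≥j j≤i i≤n) ⟩
      D s · u                      ≈⟨ ·-split u (<⇒≤ (remainder< j≤i i≤n s)) ⟩
      E · u ∙ rest s · u           ≈⟨ comm _ _ ⟩
      rest s · u ∙ E · u           ∎)
      where
      d = fib i ∸ fib j
      E = ℕ-Sum.sumTo (λ k → remainder i k * N s k) n

    solution-above : Solution u w SmallRatio n j
    solution-above = descend (≤⇒≤′ j≤n) step emptySolution
      where
      step : ∀ i → j ≤ i → i < n → Solution u w SmallRatio n (suc i) → Solution u w SmallRatio n i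
      step i j≤i i<n s =
        extendSolution smallRatio-scalable s d (rest s) (m<n⇒0<n∸m (fib-mono-< 2≤j (s≤s j≤i)))
          (eliminate (m≤n⇒m≤1+n j≤i) i<n s)
          -- The new fraction is `rest s` over d D, and `rest s` ≤ D gives the bound 1 / d.
          (≤-trans (*-monoˡ-≤ d (m∸n≤m (D s) (ℕ-Sum.sumTo (λ k → remainder (suc i) k * N s k) n)))
            (≤-reflexive (*-comm (D s) d)))
        where d = fib (suc i) ∸ fib j

    -- In row j the coefficient of w j vanishes, leaving a positive multiple of u.
    u≈ε : u ≈ ε
    u≈ε = torsionFree (rest s) (m<n⇒0<n∸m (remainder< ≤-refl j≤n s)) (begin
      rest s · u                       ≈⟨ eliminate ≤-refl j≤n s ⟨
      ((fib j ∸ fib j) * D s) · w j    ≈⟨ ×-congˡ (≡.cong (_* D s) (n∸n≡0 (fib j))) ⟩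
      ε                                ∎)
      where s = solution-above

    w₁≈ε : w 1 ≈ ε
    w₁≈ε = ⁻¹-injective (trans u≈ε (sym ε⁻¹≈ε))

    above≈ε : ∀ {k} → j < k → k ≤ n → w k ≈ ε
    above≈ε {k} j<k k≤n = torsionFree (D s) (0<D s)
      (trans (solves s k j<k k≤n) (trans (×-congʳ (N s k) u≈ε) (·-ε (N s k))))
      where s = solution-above

    -- Below j the difference of Fibonacci numbers changes sign; with w_1 gone, w_i is a nonnegative
    -- combination of later entries.
    row-<j : ∀ {i} → 2 ≤ i → i < j → (fib j ∸ fib i) · w i ≈ T i
    row-<j {i} 2≤i i<j = ∙-cancelˡ (fib i · w i) _ _ (begin
      fib i · w i ∙ (fib j ∸ fib i) · w i  ≈⟨ ·-split (w i) (<⇒≤ (fib-mono-< 2≤i i<j)) ⟨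
      fib j · w i                          ≈⟨ split-rows 2≤i (≤-trans (<⇒≤ i<j) j≤n) ⟨
      w 1 ∙ (fib i · w i ∙ T i)            ≈⟨ ∙-congʳ w₁≈ε ⟩
      ε ∙ (fib i · w i ∙ T i)              ≈⟨ identityˡ _ ⟩
      fib i · w i ∙ T i                    ∎)

    -- Numerators are nonnegative by type, so one positive numerator, at j, keeps the coefficient
    -- sum of row 1 positive.
    PositiveAtJ : ℕ → ℕ → ℕ → Set
    PositiveAtJ k D N = k ≡ j → 0 < N

    solution-all : Solution (w j) w PositiveAtJ n 0
    solution-all = descend (≤⇒≤′ z≤n) step emptySolution
      where
      Sol : ℕ → Set _
      Sol = Solution (w j) w PositiveAtJ n

      scalable : Scalable PositiveAtJ
      scalable _ _ _ d 0<d p k≡j = *-mono-≤ 0<d (p k≡j)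

      vanishing : ∀ {i} → suc i ≢ j → w (suc i) ≈ ε → Sol (suc i) → Sol i
      vanishing ≢j w≈ε s = extendSolution scalable s 1 0 (s≤s z≤n)
        (trans (×-congʳ (1 * D s) w≈ε) (·-ε (1 * D s))) (λ ≡j → contradiction ≡j ≢j)

      step : ∀ i → 0 ≤ i → i < n → Sol (suc i) → Sol i
      -- The step from i + 1 to i solves for the entry i + 1, so `zero` is the entry w_1; it differs
      -- from w_j because j ≥ 2.
      step zero    _ _ = vanishing (<⇒≢ 2≤j) w₁≈ε
      step i@(suc i′) _ i<n s with <-cmp (suc i) j
      ... | tri> _ ≢j j<1+i = vanishing ≢j (above≈ε j<1+i i<n) s
      ... | tri≈ _ ≡.refl _ = extendSolution scalable s 1 (D s) (s≤s z≤n)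
        (×-congˡ (*-identityˡ (D s))) (λ _ → 0<D s)
      ... | tri< 1+i<j ≢j _ = extendSolution scalable s d E (m<n⇒0<n∸m (fib-mono-< 2≤1+i 1+i<j))
        (begin
          (d * D s) · w (suc i)   ≈⟨ ×-congˡ (*-comm d (D s)) ⟩
          (D s * d) · w (suc i)   ≈⟨ ×-assocˡ (w (suc i)) (D s) d ⟨
          D s · (d · w (suc i))   ≈⟨ ×-congʳ (D s) (row-<j 2≤1+i 1+i<j) ⟩
          D s · T (suc i)         ≈⟨ remainder-combination s ⟩
          E · w j                 ∎)
        (λ ≡j → contradiction ≡j ≢j)
        where
        d = fib j ∸ fib (suc i)
        E = ℕ-Sum.sumTo (λ k → remainder (suc i) k * N s k) n
        2≤1+i : 2 ≤ suc i
        2≤1+i = s≤s (s≤s z≤n)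

    -- Row 1 turns into E w_j = D F_j w_1 = 0, and E > 0 because all its terms are nonnegative and
    -- the one at j is positive.
    wⱼ≈ε : w j ≈ ε
    wⱼ≈ε = torsionFree E 0<E (begin
      E · w j                                           ≈⟨ sumTo-combination (D s) (fibRedhefferEntry 1) (N s) n
                                                             (λ k 1≤k k≤n → inj₂ (solves s k 1≤k k≤n)) ⟨
      D s · sumTo (λ k → fibRedhefferEntry 1 k · w k) n ≈⟨ ×-congʳ (D s) (rows 1 ≤-refl (≤-trans (<⇒≤ 2≤j) j≤n)) ⟩
      D s · (fib j · w 1)                               ≈⟨ ×-congʳ (D s) (trans (×-congʳ (fib j) w₁≈ε) (·-ε (fib j))) ⟩
      D s · ε                                           ≈⟨ ·-ε (D s) ⟩
      ε                                                 ∎)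
      where
      s = solution-all
      E = ℕ-Sum.sumTo (λ k → fibRedhefferEntry 1 k * N s k) n
      1≤j : 1 ≤ j
      1≤j = <⇒≤ 2≤j
      entry₁ⱼ : fibRedhefferEntry 1 j ≡ 1
      entry₁ⱼ with j ≟ 1 | 1 ∣? j
      ... | yes _ | _      = ≡.refl
      ... | no _  | yes _  = ≡.refl
      ... | no _  | no 1∤j = contradiction (1∣ j) 1∤j
      0<E : 0 < E
      0<E = ≤-trans
        (≡.subst (λ e → 0 < e * N s j) (≡.sym entry₁ⱼ) (*-mono-≤ (≤-refl {1}) (property s j 1≤j j≤n ≡.refl)))
        (term≤sumTo (λ k → fibRedhefferEntry 1 k * N s k) n 1≤j j≤n)

    all≈ε : ∀ k → 1 ≤ k → k ≤ n → w k ≈ ε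
    all≈ε k 1≤k k≤n = torsionFree (D s) (0<D s)
      (trans (solves s k 1≤k k≤n) (trans (×-congʳ (N s k) wⱼ≈ε) (·-ε (N s k))))
      where s = solution-all

-- From a Heyting field of characteristic zero to its additive group

module Field {c ℓ₁ ℓ₂} (K : HeytingField c ℓ₁ ℓ₂) (charZero : CharacteristicZero K) where
  private
    module K = HeytingField K
    module R = CommutativeRing (HeytingCommutativeRing.commutativeRing K.heytingCommutativeRing)
  open R
    using (Carrier; _≈_; _≉_; 0#; 1#; _-_; trans; sym; reflexive; setoid; semiring; ring; zeroʳ;
           +-monoid; +-commutativeMonoid; +-abelianGroup)
    renaming (_*_ to _⊛_)
  open SemiringMult semiring using (×-assoc-*) renaming (_×_ to _·_)
  open RingProperties ring using (-0#≈0#)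
  open MonoidSum +-monoid using (sum-cong-≋)
  open RangeSum +-commutativeMonoid
  open SetoidReasoning setoid

  fromℕ-* : ∀ m x → fromℕ K m ⊛ x ≈ m · x
  fromℕ-* m x = trans (×-assoc-* m 1# x) (Mult.×-congʳ +-commutativeMonoid m (R.*-identityˡ x))

  apart-cancel : ∀ {a x} → a K.# 0# → a ⊛ x ≈ 0# → x ≈ 0#
  apart-cancel {a} {x} a#0 ax≈0 with K.#⇒invertible a#0
  ... | b , b[a-0]≈1 , _ = begin
    x                     ≈⟨ R.*-identityˡ x ⟨
    1# ⊛ x                ≈⟨ R.*-congʳ b[a-0]≈1 ⟨
    -- Apartness provides an inverse of the difference a - 0, not of a itself.
    b ⊛ (a - 0#) ⊛ x      ≈⟨ R.*-congʳ (R.*-congˡ (trans (R.+-congˡ -0#≈0#) (R.+-identityʳ a))) ⟩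
    b ⊛ a ⊛ x             ≈⟨ R.*-assoc b a x ⟩
    b ⊛ (a ⊛ x)           ≈⟨ R.*-congˡ ax≈0 ⟩
    b ⊛ 0#                ≈⟨ zeroʳ b ⟩
    0#                    ∎

  -- By tightness, to prove x ≈ 0 it suffices to refute x # 0, so that a ≉ 0 may be
  -- strengthened to a # 0.
  ≉-cancel : ∀ {a x} → a ≉ 0# → a ⊛ x ≈ 0# → x ≈ 0#
  ≉-cancel {a} {x} a≉0 ax≈0 = proj₁ (K.tight x 0#) λ x#0 →
    a≉0 (proj₁ (K.tight a 0#) λ a#0 → proj₂ (K.tight x 0#) (apart-cancel a#0 ax≈0) x#0)

  torsionFree : IsTorsionFree +-abelianGroup
  torsionFree (suc m) {x} _ mx≈0 = ≉-cancel (charZero m) (trans (fromℕ-* (suc m) x) mx≈0)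

  extend : ∀ {n} → Vector Carrier n → ℕ → Carrier
  extend {zero}  v k       = 0#
  extend {suc n} v zero    = v Fin.zero
  extend {suc n} v (suc k) = extend (tail v) k

  extend-toℕ : ∀ {n} (v : Vector Carrier n) i → extend v (toℕ i) ≡ v i
  extend-toℕ v Fin.zero    = ≡.refl
  extend-toℕ v (Fin.suc i) = extend-toℕ (tail v) i

  fib∉σ : ∀ n j → 2 ≤ j → j ≤ n → fromℕ K (fib j) ∉ σ K (fibRedheffer K n)
  fib∉σ n j 2≤j j≤n (v , v≉0 , eigen) = v≉0 λ i →
    trans (reflexive (≡.sym (extend-toℕ v i))) (all≈ε (suc (toℕ i)) (s≤s z≤n) (toℕ<n i))
    where
    -- `pred` turns the 0-based positions of v into the 1-based indices of the sums.
    w : ℕ → Carrier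
    w = extend v ∘ pred

    row : ∀ i → sumTo (λ k → fibRedhefferEntry (suc (toℕ i)) k · w k) n ≈ fib j · w (suc (toℕ i))
    row i = begin
      sumTo (λ k → fibRedhefferEntry (suc (toℕ i)) k · w k) n
        ≈⟨ sum≈sumTo (λ k → fibRedhefferEntry (suc (toℕ i)) k · w k) n ⟨
      _
        ≈⟨ sum-cong-≋ {n} (λ k → trans
             (reflexive (≡.cong (fibRedhefferEntry (suc (toℕ i)) (suc (toℕ k)) ·_) (extend-toℕ v k)))
             (sym (fromℕ-* (fibRedhefferEntry (suc (toℕ i)) (suc (toℕ k))) (v k)))) ⟩
      _*ᵥ_ K (fibRedheffer K n) v i
        ≈⟨ eigen i ⟩
      fromℕ K (fib j) ⊛ v i
        ≈⟨ fromℕ-* (fib j) (v i) ⟩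
      fib j · v i
        ≡⟨ ≡.cong (fib j ·_) (extend-toℕ v i) ⟨
      fib j · w (suc (toℕ i)) ∎

    rows : ∀ i → 1 ≤ i → i ≤ n → sumTo (λ k → fibRedhefferEntry i k · w k) n ≈ fib j · w i
    rows (suc i) _ i<n = ≡.subst
      (λ i → sumTo (λ k → fibRedhefferEntry (suc i) k · w k) n ≈ fib j · w (suc i))
      (toℕ-fromℕ< i<n) (row (Fin.fromℕ< i<n))

    open TorsionFree.Eigenvector +-abelianGroup torsionFree 2≤j j≤n w rows using (all≈ε)

theorem4 : {c ℓ₁ ℓ₂ : Level} (K : HeytingField c ℓ₁ ℓ₂) → CharacteristicZero K →
    (n : ℕ) → 2 ≤ n → (j : ℕ) → 1 ≤ j → j ≤ n →
    fromℕ K (fib j) ∉ σ K (fibRedheffer K n)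
-- Since F_1 and F_2 compute to the same number, j = 1 is the case j = 2, which is in range because
-- n ≥ 2.
theorem4 K charZero n 2≤n (suc zero)        _ _   = Field.fib∉σ K charZero n 2 ≤-refl 2≤n
theorem4 K charZero n 2≤n j@(suc (suc _)) _ j≤n = Field.fib∉σ K charZero n j (s≤s (s≤s z≤n)) j≤n
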